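{- Let $(S,\mathcal C)$ be a connectoid and $T$ a normal tree of $(S,\mathcal C)$. For every end $\omega$ of the tree $T$, let $R_\omega$ be the unique ray in $\omega$ starting at the root of $T$. Then $V(R_\omega)$ converges to an end $\eta(\omega)\in\Omega(S,\mathcal C)$, and the map $\omega\mapsto\eta(\omega)$ is a bijection between the ends of $T$ and the ends of $(S,\mathcal C)$ lying in the closure of $V(T)$.
   Context: A connectoid is given by a set $S$ and a set $\mathcal F$ of finite subsets of $S$ such that (i) $F\cup F'\in\mathcal F$ whenever $F,F'\in\mathcal F$ and $F\cap F'\neq\emptyset$, and (ii) $\emptyset\in\mathcal F$ and $\{s\}\in\mathcal F$ for every $s\in S$. A set $C\subseteq S$ is connected if for all $x,y\in C$ there is $F\in\mathcal F$ with $F\subseteq C$ and $x,y\in F$; $\mathcal C$ is the set of connected sets. For $S'\subseteq S$, a component of $S'$ is a maximal connected subset, and $\mathcal K(S')$ is the set of components of $S'$. "Almost all" means all but finitely many. A necklace is a connected set $N$ for which there is a family $(H_n)_{n\in\mathbb N}$ of finite connected sets with $N=\bigcup_n H_n$ and $H_i\cap H_j\neq\emptyset$ iff $|i-j|\le 1$. For finite $X\subseteq S$, the $X$-tail of $N$ is the unique element of $\mathcal K(N\setminus X)$ containing almost all elements of $N$. Two necklaces are equivalent if for every finite $X\subseteq S$ their $X$-tails lie in the same element of $\mathcal K(S\setminus X)$. An end is an equivalence class of necklaces; $\Omega(S,\mathcal C)$ is the set of ends; $K(X,\omega)$ is the element of $\mathcal K(S\setminus X)$ containing the $X$-tails of the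 necklaces in $\omega$. An infinite set $Y\subseteq S$ converges to an end $\nu$ if $K(X,\nu)$ contains almost all elements of $Y$ for every finite $X\subseteq S$. An end $\nu$ lies in the closure of a set $U\subseteq S$ if $K(X,\nu)\cap U\neq\emptyset$ for every finite $X\subseteq S$. For a rooted tree $T$ with tree order $\le_T$ and $t\in V(T)$, let $\mathrm{Down}^\circ_T(t)=\{x\in V(T):x<_T t\}$. A weak normal tree of $(S,\mathcal C)$ is a rooted undirected tree $T$ with $V(T)\subseteq S$ such that (1) for every $C\in\mathcal C$ and every two $\le_T$-incomparable $u,v\in C\cap V(T)$ there is $w\in C$ with $w\le_T u$ and $w\le_T v$, and (2) for all $u\le_T v$ in $V(T)$ there is $C\in\mathcal C$ containing $u,v$ with $C\cap\mathrm{Down}^\circ_T(u)=\emptyset$. It is a normal tree if additionally for every rooted ray $R$ of $T$ some necklace contains almost all vertices of $R$. Ends of $T$ are its graph-theoretic ends (equivalence classes of rays). -}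

module Defs where

open import Data.List using (List; []; _∷_; [_]; _++_; length)
open import Data.List.Membership.Propositional using () renaming (_∈_ to _∈ˡ_; _∉_ to _∉ˡ_)
open import Data.List.Relation.Unary.All using (All)
open import Data.Nat using (ℕ; _≤_; ∣_-_∣) renaming (suc to 1+_)
open import Data.Product using (Σ; ∃; _×_; proj₁)
open import Function.Bundles using (_⇔_)
open import Function.Definitions using (Injective)
open import Level using (_⊔_; suc)
open import Relation.Binary using (Rel; Symmetric; Irreflexive; Setoid)
import Relation.Binary.Construct.On as On
open import Relation.Binary.PropositionalEquality using (_≡_; _≢_)
open import Relation.Nullary using (¬_)
open import Relation.Unary using (Pred; _∈_; _⊆_; _≐_; _≬_; _∖_; ∁)
open import Relation.Unary.Relation.Binary.Equality using (≐-setoid)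

-- Subsets of S are predicates, compared by _≐_.  Finite subsets are given by
-- lists, of which only the underlying set ⟦ X ⟧ ever matters.

⟦_⟧ : ∀ {a} {S : Set a} → List S → Pred S a
⟦ X ⟧ x = x ∈ˡ X

Finite : ∀ {a} {S : Set a} → Pred S a → Set a
Finite P = ∃ λ X → P ≐ ⟦ X ⟧

infix 4 _⊆*_

-- P contains almost all elements of Y.
_⊆*_ : ∀ {a} {S : Set a} → Pred S a → Pred S a → Set a
Y ⊆* P = Finite (Y ∖ P)

-- A class modulo _~_ is an actual subset of A, so that classes are compared
-- extensionally.  In both uses below _~_ is (classically) an equivalence
-- relation; the definition itself does not need a proof of that.
record Class {a ℓ} {A : Set a} (_~_ : Rel A ℓ) : Set (a ⊔ suc ℓ) where
  field
    members : Pred A ℓ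
    isClass : ∃ λ x → members ≐ (x ~_)

open Class public

classes : ∀ {a ℓ} {A : Set a} → Rel A ℓ → Setoid (a ⊔ suc ℓ) (a ⊔ ℓ)
classes {ℓ = ℓ} {A} _~_ = On.setoid {B = Class _~_} (≐-setoid A ℓ) members

------------------------------------------------------------------------
-- Connectoids, necklaces and ends

record Connectoid a : Set (suc a) where
  field
    S : Set a
    𝓕 : Pred (List S) a
    𝓕-resp-≐    : ∀ {F F′} → ⟦ F ⟧ ≐ ⟦ F′ ⟧ → 𝓕 F → 𝓕 F′
    𝓕-∪         : ∀ {F F′} → 𝓕 F → 𝓕 F′ → ⟦ F ⟧ ≬ ⟦ F′ ⟧ → 𝓕 (F ++ F′)
    𝓕-∅         : 𝓕 []
    𝓕-singleton : ∀ s → 𝓕 [ s ]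

module _ {a} (𝒮 : Connectoid a) where
  open Connectoid 𝒮

  Connected : Pred S a → Set a
  Connected C = ∀ x y → x ∈ C → y ∈ C →
    ∃ λ F → 𝓕 F × ⟦ F ⟧ ⊆ C × x ∈ ⟦ F ⟧ × y ∈ ⟦ F ⟧

  -- K ∈ 𝒦 S′: K is a component of S′.
  record 𝒦 (S′ K : Pred S a) : Set (suc a) where
    field
      subset    : K ⊆ S′
      connected : Connected K
      maximal   : ∀ D → D ⊆ S′ → Connected D → K ⊆ D → D ⊆ K

  record IsNecklace (N : Pred S a) : Set a where
    field
      connected   : Connected N
      H           : ℕ → List S
      H-connected : ∀ n → Connected ⟦ H n ⟧
      H-union     : N ≐ λ x → ∃ λ n → x ∈ ⟦ H n ⟧
      H-meet      : ∀ i j → ⟦ H i ⟧ ≬ ⟦ H j ⟧ ⇔ ∣ i - j ∣ ≤ 1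

  Necklace : Set (suc a)
  Necklace = Σ (Pred S a) IsNecklace

  -- D is the X-tail of N.
  IsTail : List S → Necklace → Pred S a → Set (suc a)
  IsTail X N D = 𝒦 (proj₁ N ∖ ⟦ X ⟧) D × proj₁ N ⊆* D

  TailIn : List S → Necklace → Pred S a → Set (suc a)
  TailIn X N K = ∃ λ D → IsTail X N D × D ⊆ K

  Equivalent : Rel Necklace (suc a)
  Equivalent N M = ∀ X → ∃ λ K → 𝒦 (∁ ⟦ X ⟧) K × TailIn X N K × TailIn X M K

  End : Set (suc (suc a))
  End = Class Equivalent

  Ends : Setoid (suc (suc a)) (suc a)
  Ends = classes Equivalent

  -- K = K(X,ω).
  IsK : List S → End → Pred S a → Set (suc a)
  IsK X ω K = 𝒦 (∁ ⟦ X ⟧) K × (∀ N → N ∈ members ω → TailIn X N K)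

  ConvergesTo : Pred S a → End → Set (suc a)
  ConvergesTo Y ν = ¬ Finite Y × (∀ X → ∃ λ K → IsK X ν K × Y ⊆* K)

  InClosure : Pred S a → End → Set (suc a)
  InClosure U ν = ∀ X → ∃ λ K → IsK X ν K × K ≬ U

  EndsInClosure : Pred S a → Setoid (suc (suc a)) (suc a)
  EndsInClosure U = On.setoid {B = Σ End (InClosure U)} Ends proj₁

------------------------------------------------------------------------
-- Graphs on subsets of S, rooted trees and their ends

record Graph {a} (S : Set a) : Set (suc a) where
  field
    V      : Pred S a
    Adj    : Rel S a
    Adj-V  : ∀ {x y} → Adj x y → x ∈ V × y ∈ V
    sym    : Symmetric Adj
    irrefl : Irreflexive _≡_ Adj

module _ {a} {S : Set a} (G : Graph S) where
  open Graph G

  -- Path u v xs: xs is the list of vertices, without repetition, of a path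
  -- of G from u to v.
  data Path : S → S → List S → Set a where
    single : ∀ {v} → v ∈ V → Path v v [ v ]
    cons   : ∀ {u v w xs} → Adj u v → u ∉ˡ xs → Path v w xs → Path u w (u ∷ xs)

  -- u and v lie in the same component of G − X.
  JoinedAvoiding : List S → Rel S a
  JoinedAvoiding X u v = ∃ λ xs → Path u v xs × All (_∉ˡ X) xs

  record IsTree : Set a where
    field
      connected : ∀ {u v} → u ∈ V → v ∈ V → ∃ λ xs → Path u v xs
      acyclic   : ∀ {u v xs} → Path u v xs → 3 ≤ length xs → ¬ Adj v u

  record Ray : Set a where
    field
      vertex    : ℕ → S
      injective : Injective _≡_ _≡_ vertex
      adjacent  : ∀ n → Adj (vertex n) (vertex (1+ n))

  open Ray public

  vertices : Ray → Pred S a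
  vertices R x = ∃ λ n → vertex R n ≡ x

  -- For every finite set X of vertices, some tails of R and Q lie in the same
  -- component of G − X.
  RayEquivalent : Rel Ray a
  RayEquivalent R Q = ∀ X → All V X → ∃ λ m → ∃ λ n →
    ∀ i j → m ≤ i → n ≤ j → JoinedAvoiding X (vertex R i) (vertex Q j)

  GraphEnd : Set (suc a)
  GraphEnd = Class RayEquivalent

  GraphEnds : Setoid (suc a) a
  GraphEnds = classes RayEquivalent

  _≗ᴿ_ : Rel Ray a
  R ≗ᴿ Q = ∀ n → vertex R n ≡ vertex Q n

record RootedTree {a} (S : Set a) : Set (suc a) where
  field
    graph  : Graph S
    isTree : IsTree graph
    root   : S
    root∈V : root ∈ Graph.V graph

  open Graph graph public

  infix 4 _≤ᵀ_ _<ᵀ_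

  -- u lies on the path from the root to v.
  _≤ᵀ_ : Rel S a
  u ≤ᵀ v = ∃ λ xs → Path graph root v xs × u ∈ˡ xs

  _<ᵀ_ : Rel S a
  u <ᵀ v = u ≤ᵀ v × u ≢ v

  Down° : S → Pred S a
  Down° t x = x <ᵀ t

  Rooted : Ray graph → Set a
  Rooted R = vertex R 0 ≡ root

  -- R is a ray of the end ω of the tree starting at the root.
  IsRootedRayOf : GraphEnd graph → Ray graph → Set a
  IsRootedRayOf ω R = R ∈ members ω × Rooted R

------------------------------------------------------------------------
-- Normal trees

module _ {a} (𝒮 : Connectoid a) (T : RootedTree (Connectoid.S 𝒮)) where
  open Connectoid 𝒮
  open RootedTree T

  record IsWeakNormalTree : Set (suc a) where
    field
      incomparable : ∀ C → Connected 𝒮 C → ∀ u v →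
        u ∈ C → u ∈ V → v ∈ C → v ∈ V → ¬ (u ≤ᵀ v) → ¬ (v ≤ᵀ u) →
        ∃ λ w → w ∈ C × w ≤ᵀ u × w ≤ᵀ v
      comparable   : ∀ u v → u ≤ᵀ v →
        ∃ λ C → Connected 𝒮 C × u ∈ C × v ∈ C × ¬ (C ≬ Down° u)

  record IsNormalTree : Set (suc a) where
    field
      isWeakNormalTree : IsWeakNormalTree
      rayNecklace      : ∀ R → Rooted R →
        ∃ λ (N : Necklace 𝒮) → vertices graph R ⊆* proj₁ N

{-# OPTIONS --safe #-}
-- By condition (1) a connected set meeting V(T) has a least vertex in T.  Hence
-- deleting the ancestors of a vertex v separates the cone above v from the rest
-- of V(T), so distinct rooted rays converge to distinct ends.  For an end ν in
-- the closure of V(T), the vertices lying below all of K(X,ν) ∩ V(T) for some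
-- finite X form an unbounded down-closed chain: for X and Y one has a common
-- upper bound in K(X ∪ Y,ν), and adding v to X forces the least vertex of
-- K(X,ν) strictly above v.  This chain is a rooted ray meeting every K(X,ν), so
-- the end to which it converges is ν.  Excluded middle is applied to untruncated
-- types and therefore also provides choice.

module Submission where

open import Defs
open import Axiom.ExcludedMiddle using (ExcludedMiddle)
open import Data.Empty using (⊥-elim)
open import Data.List using (List; []; _∷_; _++_; concatMap; filter; length; upTo)
open import Data.List.Membership.Propositional using (lose) renaming (_∈_ to _∈ˡ_; _∉_ to _∉ˡ_)
open import Data.List.Membership.Propositional.Properties
  using (∈-concatMap⁺; ∈-filter⁺; ∈-filter⁻; ∈-upTo⁺; ∈-++⁺ˡ; ∈-++⁺ʳ; ∈-++⁻)
open import Data.List.Relation.Unary.All using (All; []; _∷_)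
import Data.List.Relation.Unary.All as All
open import Data.List.Relation.Unary.Any using (here; there)
open import Data.Nat using (ℕ; zero; _+_; _∸_; _≤_; _<_; _⊔_; ∣_-_∣; z≤n; s≤s; s≤s⁻¹)
  renaming (suc to 1+_)
open import Data.Nat.Properties
open import Data.Product using (Σ; ∃; ∃!; _×_; _,_; proj₁; proj₂)
open import Data.Sum using (_⊎_; inj₁; inj₂; [_,_])
open import Function using (_∘_; id)
open import Function.Bundles using (Bijection; Equivalence)
open import Function.Definitions using (Injective)
open import Level using (Level; suc; Lift; lift; lower) renaming (_⊔_ to _⊔ˡ_)
open import Relation.Binary using (Rel; Setoid)
open import Relation.Binary.Construct.Closure.ReflexiveTransitive as Star
  using (Star; ε; _◅_; _◅◅_; reverse)
open import Relation.Binary.PropositionalEquality using (_≡_; _≢_; refl; sym; trans; cong; subst)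
open import Relation.Nullary using (¬_; Dec; yes; no)
open import Relation.Nullary.Decidable using (map′; decidable-stable)
open import Relation.Unary using (Pred; _∈_; _∉_; _⊆_; _≬_; _∖_; _∪_; ∁)

-- Finite sets, almost inclusion and eventual avoidance.

lowerExcludedMiddle : ∀ {a} → ExcludedMiddle (suc a) → ExcludedMiddle a
lowerExcludedMiddle {a} em {P} = map′ lower lift (em {Lift (suc a) P})

-- Finitely many thresholds have a maximum. This makes injective sequences, the pieces of a necklace
-- and the vertices of a rooted ray leave any finite set behind.
eventually : ∀ {a p} {S : Set a} (P : ℕ → Pred S p) →
  (∀ x → ∃ λ k → ∀ n → k ≤ n → P n x) →
  ∀ X → ∃ λ k → ∀ n → k ≤ n → ∀ x → x ∈ˡ X → P n x
eventually P bound [] = 0 , λ _ _ _ ()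
eventually P bound (x ∷ X) with k , f ← bound x | l , g ← eventually P bound X =
  k ⊔ l , λ where
    n k⊔l≤n _ (here refl) → f n (≤-trans (m≤m⊔n k l) k⊔l≤n)
    n k⊔l≤n y (there y∈X) → g n (≤-trans (m≤n⊔m k l) k⊔l≤n) y y∈X

module _ {a} (em : ExcludedMiddle a) {S : Set a} where

  -- `Finite` asks for a list with exactly the elements of `P`; excluded middle decides `P`, so a
  -- covering list can be filtered.
  ⊆-list⇒Finite : ∀ {P : Pred S a} X → P ⊆ ⟦ X ⟧ → Finite P
  ⊆-list⇒Finite {P} X P⊆X = filter P? X ,
    (λ x∈P → ∈-filter⁺ P? (P⊆X x∈P) x∈P) , (λ x∈ → proj₂ (∈-filter⁻ P? {xs = X} x∈))
    where
    P? : ∀ x → Dec (P x)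
    P? x = em

  ⊆*-mono : ∀ {Y P Q : Pred S a} → Y ⊆* P → P ⊆ Q → Y ⊆* Q
  ⊆*-mono (X , sub , _) P⊆Q =
    ⊆-list⇒Finite X λ (y∈Y , y∉Q) → sub (y∈Y , y∉Q ∘ P⊆Q)

  ⊆*-trans : ∀ {Y P Q : Pred S a} → Y ⊆* P → P ⊆* Q → Y ⊆* Q
  ⊆*-trans {Y} {P} {Q} (X , sub , _) (X′ , sub′ , _) = ⊆-list⇒Finite (X ++ X′) λ {y} → to y
    where
    to : ∀ y → y ∈ Y ∖ Q → y ∈ˡ X ++ X′
    to y (y∈Y , y∉Q) with em {y ∈ P}
    ... | yes y∈P = ∈-++⁺ʳ X (sub′ (y∈P , y∉Q))
    ... | no  y∉P = ∈-++⁺ˡ (sub (y∈Y , y∉P))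

  -- If `P` and `Q` were disjoint, the two exceptional lists together would cover `Y`. This is why
  -- at most one component contains almost all of an infinite set.
  ⊆*-meet : ∀ {Y P Q : Pred S a} → ¬ Finite Y → Y ⊆* P → Y ⊆* Q → P ≬ Q
  ⊆*-meet {Y} {P} {Q} inf (X , sub , _) (X′ , sub′ , _) =
    decidable-stable em λ disjoint → inf (⊆-list⇒Finite (X ++ X′) λ {y} → to disjoint y)
    where
    to : ¬ (P ≬ Q) → ∀ y → y ∈ Y → y ∈ˡ X ++ X′
    to disjoint y y∈Y with em {y ∈ P}
    ... | yes y∈P = ∈-++⁺ʳ X (sub′ (y∈Y , λ y∈Q → disjoint (y , y∈P , y∈Q)))
    ... | no  y∉P = ∈-++⁺ˡ (sub (y∈Y , y∉P))

  injective-avoids : (f : ℕ → S) → Injective _≡_ _≡_ f →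
    ∀ X → ∃ λ k → ∀ n → k ≤ n → f n ∉ˡ X
  injective-avoids f inj X =
    let k , avoid = eventually (λ n x → f n ≢ x) bound X in
    k , λ n k≤n fn∈X → avoid n k≤n (f n) fn∈X refl
    where
    bound : ∀ x → ∃ λ k → ∀ n → k ≤ n → f n ≢ x
    bound x with em {∃ λ n → f n ≡ x}
    ... | no ∄n = 0 , λ n _ fn≡x → ∄n (n , fn≡x)
    ... | yes (m , fm≡x) = 1+ m , λ n m<n fn≡x →
      <⇒≢ m<n (inj (trans fm≡x (sym fn≡x)))

-- Components, tails and limits

module Limits {a} (em : ExcludedMiddle a) (𝒮 : Connectoid a) where
  open Connectoid 𝒮

  -- `Connected C` unfolds to this relation holding between all points of `C`, and `Linked S′ z`
  -- serves as the component of `z` in `S′`.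
  Linked : Pred S a → Rel S a
  Linked C x y = ∃ λ F → 𝓕 F × ⟦ F ⟧ ⊆ C × x ∈ ⟦ F ⟧ × y ∈ ⟦ F ⟧

  linked-sym : ∀ {C x y} → Linked C x y → Linked C y x
  linked-sym (F , F∈𝓕 , F⊆C , x∈F , y∈F) = F , F∈𝓕 , F⊆C , y∈F , x∈F

  linked-trans : ∀ {C x y z} → Linked C x y → Linked C y z → Linked C x z
  linked-trans {y = y} (F , F∈𝓕 , F⊆C , x∈F , y∈F) (G , G∈𝓕 , G⊆C , y∈G , z∈G) =
    F ++ G , 𝓕-∪ F∈𝓕 G∈𝓕 (y , y∈F , y∈G) ,
    [ F⊆C , G⊆C ] ∘ ∈-++⁻ F , ∈-++⁺ˡ x∈F , ∈-++⁺ʳ F z∈G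

  linked-mono : ∀ {C D x y} → C ⊆ D → Linked C x y → Linked D x y
  linked-mono C⊆D (F , F∈𝓕 , F⊆C , x∈F , y∈F) = F , F∈𝓕 , C⊆D ∘ F⊆C , x∈F , y∈F

  linked-refl : ∀ {C x} → x ∈ C → Linked C x x
  linked-refl {x = x} x∈C =
    x ∷ [] , 𝓕-singleton x , (λ { (here refl) → x∈C }) , here refl , here refl

  hub⇒Connected : ∀ {C} z → (∀ x → x ∈ C → Linked C z x) → Connected 𝒮 C
  hub⇒Connected z hub x y x∈C y∈C = linked-trans (linked-sym (hub x x∈C)) (hub y y∈C)

  Connected-∪ : ∀ {C D} → Connected 𝒮 C → Connected 𝒮 D → C ≬ D → Connected 𝒮 (C ∪ D)
  Connected-∪ C-conn D-conn (z , z∈C , z∈D) = hub⇒Connected z λ where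
    x (inj₁ x∈C) → linked-mono inj₁ (C-conn z x z∈C x∈C)
    x (inj₂ x∈D) → linked-mono inj₂ (D-conn z x z∈D x∈D)

  component : ∀ {S′ z} → z ∈ S′ → 𝒦 𝒮 S′ (Linked S′ z)
  component {S′} {z} z∈S′ = record
    { subset    = λ (_ , _ , F⊆S′ , _ , x∈F) → F⊆S′ x∈F
    ; connected = hub⇒Connected z λ where
        x (F , F∈𝓕 , F⊆S′ , z∈F , x∈F) →
          -- The witness `F` itself lies in the component: each of its points is linked to `z`
          -- through `F`.
          F , F∈𝓕 , (λ y∈F → F , F∈𝓕 , F⊆S′ , z∈F , y∈F) , z∈F , x∈F
    ; maximal   = λ D D⊆S′ D-conn K⊆D x∈D →
        linked-mono D⊆S′ (D-conn z _ (K⊆D (linked-refl z∈S′)) x∈D)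
    }

  -- Maximality is applied to `K ∪ D`, which is connected because the two sets meet.
  absorb : ∀ {S′ K D} → 𝒦 𝒮 S′ K → D ⊆ S′ → Connected 𝒮 D → K ≬ D → D ⊆ K
  absorb 𝒦K D⊆S′ D-conn K≬D x∈D = maximal _ [ subset , D⊆S′ ]
    (Connected-∪ connected D-conn K≬D) inj₁ (inj₂ x∈D)
    where open 𝒦 𝒦K

  -- When `S″` is `S′`, applying this both ways shows that components that meet coincide; when more
  -- is deleted to obtain `S″`, it nests the components belonging to one end.
  component-mono : ∀ {S′ S″ K K′} → 𝒦 𝒮 S′ K → 𝒦 𝒮 S″ K′ → S″ ⊆ S′ → K ≬ K′ → K′ ⊆ K
  component-mono 𝒦K 𝒦K′ S″⊆S′ = absorb 𝒦K (S″⊆S′ ∘ 𝒦.subset 𝒦K′) (𝒦.connected 𝒦K′)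

  -- Necklaces and their tails.

  module _ (N : Necklace 𝒮) where
    open IsNecklace (proj₂ N)

    H-nonempty : ∀ n → ∃ λ x → x ∈ ⟦ H n ⟧
    H-nonempty n with x , x∈Hn , _ ←
      Equivalence.from (H-meet n n) (≤-trans (≤-reflexive (∣n-n∣≡0 n)) z≤n) = x , x∈Hn

    H-consecutive : ∀ n → ⟦ H n ⟧ ≬ ⟦ H (1+ n) ⟧
    H-consecutive n = Equivalence.from (H-meet n (1+ n)) (≤-reflexive (distance n))
      where
      distance : ∀ n → ∣ n - 1+ n ∣ ≡ 1
      distance zero   = refl
      distance (1+ n) = distance n

    H-avoids : ∀ X → ∃ λ k → ∀ n → k ≤ n → ∀ x → x ∈ˡ X → x ∉ ⟦ H n ⟧
    H-avoids = eventually (λ n x → x ∉ ⟦ H n ⟧) bound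
      where
      bound : ∀ x → ∃ λ k → ∀ n → k ≤ n → x ∉ ⟦ H n ⟧
      bound x with em {∃ λ n → x ∈ ⟦ H n ⟧}
      ... | no ∄n = 0 , λ n _ x∈Hn → ∄n (n , x∈Hn)
      -- A point of `H m` lies in `H n` only if `n` and `m` differ by at most 1, so `2 + m` is a
      -- safe threshold.
      ... | yes (m , x∈Hm) = 2 + m , λ n 2+m≤n x∈Hn → 1+n≰n (
        ≤-trans (m+n≤o⇒m≤o∸n 2 2+m≤n)
          (≤-trans (m∸n≤∣m-n∣ n m) (Equivalence.to (H-meet n m) (x , x∈Hn , x∈Hm))))

    necklace-infinite : ¬ Finite (proj₁ N)
    necklace-infinite (X , N⊆X , _)
      with k , avoid ← H-avoids X | x , x∈Hk ← H-nonempty (proj₁ (H-avoids X)) =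
      avoid k ≤-refl x (N⊆X (proj₂ H-union (k , x∈Hk))) x∈Hk

    -- Indexing by `n + k` instead of a bound `k ≤ n` lets connectedness go by induction on `n`,
    -- through consecutive pieces.
    H-from : ℕ → Pred S a
    H-from k x = ∃ λ n → x ∈ ⟦ H (n + k) ⟧

    H-from-connected : ∀ k → Connected 𝒮 (H-from k)
    H-from-connected k = hub⇒Connected z λ x (n , x∈Hn) → hub n x x∈Hn
      where
      z    = proj₁ (H-nonempty k)
      z∈Hk = proj₂ (H-nonempty k)

      hub : ∀ n x → x ∈ ⟦ H (n + k) ⟧ → Linked (H-from k) z x
      hub zero   x x∈Hk = linked-mono (zero ,_) (H-connected k z x z∈Hk x∈Hk)
      hub (1+ n) x x∈H with y , y∈Hn , y∈H ← H-consecutive (n + k) =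
        linked-trans (hub n y y∈Hn) (linked-mono (1+ n ,_) (H-connected (1+ n + k) y x y∈H x∈H))

    -- The pieces from some index on avoid `X` and form a connected set, hence lie in one component;
    -- the remaining points are covered by the finitely many earlier pieces, which are finite.
    tail : ∀ X → ∃ λ D → IsTail 𝒮 X N D
    tail X with k , avoid ← H-avoids X =
      Linked N∖X z , component z∈N∖X , ⊆-list⇒Finite em (concatMap H (upTo k)) λ {x} → rest x
      where
      N∖X  = proj₁ N ∖ ⟦ X ⟧
      z    = proj₁ (H-nonempty k)

      from⊆N∖X : H-from k ⊆ N∖X
      from⊆N∖X (n , x∈Hn) =
        proj₂ H-union (n + k , x∈Hn) , λ x∈X → avoid (n + k) (m≤n+m k n) _ x∈X x∈Hn

      z∈N∖X : z ∈ N∖X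
      z∈N∖X = from⊆N∖X (zero , proj₂ (H-nonempty k))

      from⊆D : H-from k ⊆ Linked N∖X z
      from⊆D = absorb (component z∈N∖X) from⊆N∖X (H-from-connected k)
        (z , linked-refl z∈N∖X , zero , proj₂ (H-nonempty k))

      rest : ∀ x → x ∈ proj₁ N ∖ Linked N∖X z → x ∈ˡ concatMap H (upTo k)
      rest x (x∈N , x∉D) with n , x∈Hn ← proj₁ H-union x∈N with n <? k
      ... | yes n<k = ∈-concatMap⁺ H (lose (∈-upTo⁺ n<k) x∈Hn)
      ... | no  n≮k = ⊥-elim (x∉D (from⊆D (n ∸ k ,
        subst (λ m → x ∈ˡ H m) (sym (m∸n+n≡m (≮⇒≥ n≮k))) x∈Hn)))

    -- With its converse `⊆*⇒TailIn`, this reduces questions about tails to almost inclusion of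
    -- necklaces in components.
    TailIn⇒⊆* : ∀ {X K} → TailIn 𝒮 X N K → proj₁ N ⊆* K
    TailIn⇒⊆* (D , (_ , N⊆*D) , D⊆K) = ⊆*-mono em N⊆*D D⊆K

    ⊆*⇒TailIn : ∀ {X K} → 𝒦 𝒮 (∁ ⟦ X ⟧) K → proj₁ N ⊆* K → TailIn 𝒮 X N K
    ⊆*⇒TailIn {X} 𝒦K N⊆*K with D , (𝒦D , N⊆*D) ← tail X = D , (𝒦D , N⊆*D) ,
      absorb 𝒦K (proj₂ ∘ 𝒦.subset 𝒦D) (𝒦.connected 𝒦D) (⊆*-meet em necklace-infinite N⊆*K N⊆*D)

    component-of-tail : ∀ X → ∃ λ K → 𝒦 𝒮 (∁ ⟦ X ⟧) K × proj₁ N ⊆* K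
    component-of-tail X with D , (𝒦D , N⊆*D) ← tail X
      -- Meeting `D` with itself merely produces a point of the tail.
      with z , z∈D , _ ← ⊆*-meet em necklace-infinite N⊆*D N⊆*D =
      Linked (∁ ⟦ X ⟧) z , component z∉X , ⊆*-mono em N⊆*D
        (absorb (component z∉X) (proj₂ ∘ 𝒦.subset 𝒦D) (𝒦.connected 𝒦D) (z , linked-refl z∉X , z∈D))
      where
      z∉X = proj₂ (𝒦.subset 𝒦D z∈D)

  -- Equivalence of necklaces, ends and limits.

  equivalent : ∀ N M →
    (∀ X → ∃ λ K → 𝒦 𝒮 (∁ ⟦ X ⟧) K × proj₁ N ⊆* K × proj₁ M ⊆* K) → Equivalent 𝒮 N M
  equivalent N M f X with K , 𝒦K , N⊆*K , M⊆*K ← f X =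
    K , 𝒦K , ⊆*⇒TailIn N 𝒦K N⊆*K , ⊆*⇒TailIn M 𝒦K M⊆*K

  -- The component supplied by the equivalence meets `K` in points of `N`, so it is contained in
  -- `K`.
  equivalent-transfer : ∀ N M → Equivalent 𝒮 N M →
    ∀ {X K} → 𝒦 𝒮 (∁ ⟦ X ⟧) K → proj₁ N ⊆* K → proj₁ M ⊆* K
  equivalent-transfer N M N~M {X} 𝒦K N⊆*K with K′ , 𝒦K′ , N-tail , M-tail ← N~M X =
    ⊆*-mono em (TailIn⇒⊆* M M-tail) (component-mono 𝒦K 𝒦K′ id
      (⊆*-meet em (necklace-infinite N) N⊆*K (TailIn⇒⊆* N N-tail)))

  equivalent-refl : ∀ N → Equivalent 𝒮 N N
  equivalent-refl N = equivalent N N λ X →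
    let K , 𝒦K , N⊆*K = component-of-tail N X in K , 𝒦K , N⊆*K , N⊆*K

  equivalent-sym : ∀ N M → Equivalent 𝒮 N M → Equivalent 𝒮 M N
  equivalent-sym N M N~M X with K , 𝒦K , N-tail , M-tail ← N~M X = K , 𝒦K , M-tail , N-tail

  equivalent-trans : ∀ N M L → Equivalent 𝒮 N M → Equivalent 𝒮 M L → Equivalent 𝒮 N L
  equivalent-trans N M L N~M M~L = equivalent N L λ X →
    let K , 𝒦K , N⊆*K = component-of-tail N X in
    K , 𝒦K , N⊆*K , equivalent-transfer M L M~L 𝒦K (equivalent-transfer N M N~M 𝒦K N⊆*K)

  endOf : Necklace 𝒮 → End 𝒮
  endOf N = record { members = Equivalent 𝒮 N ; isClass = N , id , id }

  representative : End 𝒮 → Necklace 𝒮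
  representative ν = proj₁ (isClass ν)

  equivalent⇒≈ : ∀ ν ν′ → Equivalent 𝒮 (representative ν) (representative ν′) →
    Setoid._≈_ (Ends 𝒮) ν ν′
  equivalent⇒≈ ν ν′ N~N′ =
    (λ {M} M∈ν → proj₂ (proj₂ (isClass ν′))
      (equivalent-trans N′ N M (equivalent-sym N N′ N~N′) (proj₁ (proj₂ (isClass ν)) M∈ν))) ,
    (λ {M} M∈ν′ → proj₂ (proj₂ (isClass ν))
      (equivalent-trans N N′ M N~N′ (proj₁ (proj₂ (isClass ν′)) M∈ν′)))
    where
    N  = representative ν
    N′ = representative ν′

  IsK⇒⊆* : ∀ ν {X K} → IsK 𝒮 X ν K → proj₁ (representative ν) ⊆* K
  IsK⇒⊆* ν (_ , tails) = TailIn⇒⊆* (representative ν)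
    (tails _ (proj₂ (proj₂ (isClass ν)) {representative ν} (equivalent-refl (representative ν))))

  -- One representative suffices to identify the component of an end, since equivalence carries
  -- almost inclusion to every other member.
  ⊆*⇒IsK : ∀ ν {X K} → 𝒦 𝒮 (∁ ⟦ X ⟧) K → proj₁ (representative ν) ⊆* K → IsK 𝒮 X ν K
  ⊆*⇒IsK ν 𝒦K N⊆*K = 𝒦K , λ M M∈ν →
    ⊆*⇒TailIn M 𝒦K
      (equivalent-transfer (representative ν) M (proj₁ (proj₂ (isClass ν)) M∈ν) 𝒦K N⊆*K)

  ⊆*⇒ConvergesTo : ∀ {Y} N → ¬ Finite Y → Y ⊆* proj₁ N → ConvergesTo 𝒮 Y (endOf N)
  ⊆*⇒ConvergesTo N inf Y⊆*N = inf , λ X →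
    let K , 𝒦K , N⊆*K = component-of-tail N X in
    K , ⊆*⇒IsK (endOf N) 𝒦K N⊆*K , ⊆*-trans em Y⊆*N N⊆*K

  limit-unique : ∀ {Y} ν ν′ → ConvergesTo 𝒮 Y ν → ConvergesTo 𝒮 Y ν′ →
    Setoid._≈_ (Ends 𝒮) ν ν′
  limit-unique ν ν′ (inf , Y→ν) (_ , Y→ν′) =
    equivalent⇒≈ ν ν′ (equivalent (representative ν) (representative ν′) λ X →
    let K  , K-ν   , Y⊆*K  = Y→ν X
        K′ , K′-ν′ , Y⊆*K′ = Y→ν′ X in
    K , proj₁ K-ν , IsK⇒⊆* ν K-ν , ⊆*-mono em (IsK⇒⊆* ν′ K′-ν′)
      (component-mono (proj₁ K-ν) (proj₁ K′-ν′) id (⊆*-meet em inf Y⊆*K Y⊆*K′)))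

  converges-resp-≈ : ∀ {Y} ν ν′ → Setoid._≈_ (Ends 𝒮) ν ν′ →
    ConvergesTo 𝒮 Y ν → ConvergesTo 𝒮 Y ν′
  converges-resp-≈ ν ν′ (_ , ν′⊆ν) (inf , Y→ν) = inf , λ X →
    let K , (𝒦K , tails) , Y⊆*K = Y→ν X in
    K , (𝒦K , λ M M∈ν′ → tails M (ν′⊆ν {M} M∈ν′)) , Y⊆*K

-- The tree order and rooted rays

module TreeOrder {a} (em : ExcludedMiddle a) {S : Set a} (T : RootedTree S) where
  open RootedTree T renaming (sym to Adj-sym)
  open IsTree isTree

  -- Walks inside `W`: with repetitions allowed they compose and reverse freely. The empty walk puts
  -- no condition on its endpoint, hence the assumptions on `x` in `joined⇒path`.
  Joined : ∀ {p} → Pred S p → Rel S (a ⊔ˡ p)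
  Joined W = Star (λ x y → Adj x y × x ∈ W × y ∈ W)

  joined-sym : ∀ {p} {W : Pred S p} {x y} → Joined W x y → Joined W y x
  joined-sym = reverse λ (xy , x∈W , y∈W) → Adj-sym xy , y∈W , x∈W

  joined-mono : ∀ {p q} {W : Pred S p} {W′ : Pred S q} → W ⊆ W′ →
    ∀ {x y} → Joined W x y → Joined W′ x y
  joined-mono W⊆W′ = Star.map λ (xy , x∈W , y∈W) → xy , W⊆W′ x∈W , W⊆W′ y∈W

  source∈ : ∀ {x y xs} → Path graph x y xs → x ∈ˡ xs
  source∈ (single _)   = here refl
  source∈ (cons _ _ _) = here refl

  target∈ : ∀ {x y xs} → Path graph x y xs → y ∈ˡ xs
  target∈ (single _)   = here refl
  target∈ (cons _ _ p) = there (target∈ p)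

  path⊆V : ∀ {x y xs} → Path graph x y xs → ⟦ xs ⟧ ⊆ V
  path⊆V (single v∈V) (here refl) = v∈V
  path⊆V (cons e _ _) (here refl) = proj₁ (Adj-V e)
  path⊆V (cons _ _ p) (there z∈)  = path⊆V p z∈

  -- The strict drop in length for `z ≢ x` is what makes heights strictly monotone.
  path-suffix : ∀ {x y z xs} → Path graph x y xs → z ∈ˡ xs →
    ∃ λ ys → Path graph z y ys × ⟦ ys ⟧ ⊆ ⟦ xs ⟧ ×
      length ys ≤ length xs × (z ≢ x → length ys < length xs)
  path-suffix p@(single _)   (here refl) = _ , p , id , ≤-refl , λ z≢z → ⊥-elim (z≢z refl)
  path-suffix p@(cons _ _ _) (here refl) = _ , p , id , ≤-refl , λ z≢z → ⊥-elim (z≢z refl)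
  path-suffix (cons _ _ p)   (there z∈) with ys , q , ys⊆ , ys≤ , _ ← path-suffix p z∈ =
    ys , q , there ∘ ys⊆ , m≤n⇒m≤1+n ys≤ , λ _ → s≤s ys≤

  path⇒joined : ∀ {p} {W : Pred S p} {x y xs} → Path graph x y xs → ⟦ xs ⟧ ⊆ W → Joined W x y
  path⇒joined (single _)   xs⊆W = ε
  path⇒joined (cons e _ p) xs⊆W =
    (e , xs⊆W (here refl) , xs⊆W (there (source∈ p))) ◅ path⇒joined p (xs⊆W ∘ there)

  -- Loop erasure: if `x` recurs later, the path is cut down to its suffix starting at `x`.
  joined⇒path : ∀ {p} {W : Pred S p} {x y} → x ∈ V → x ∈ W → Joined W x y →
    ∃ λ xs → Path graph x y xs × ⟦ xs ⟧ ⊆ W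
  joined⇒path x∈V x∈W ε = _ , single x∈V , λ { (here refl) → x∈W }
  joined⇒path {x = x} x∈V x∈W ((e , _ , z∈W) ◅ s)
    with xs , p , xs⊆W ← joined⇒path (proj₂ (Adj-V e)) z∈W s
    with em {x ∈ˡ xs}
  ... | no  x∉xs = x ∷ xs , cons e x∉xs p , λ { (here refl) → x∈W ; (there y∈) → xs⊆W y∈ }
  ... | yes x∈xs with ys , q , ys⊆xs , _ ← path-suffix p x∈xs = ys , q , xs⊆W ∘ ys⊆xs

  -- If the second vertices w and w′ differed, the two paths would join them
  -- while avoiding x, closing a cycle through x.
  path-unique : ∀ {x y xs ys} → Path graph x y xs → Path graph x y ys → xs ≡ ys
  path-unique (single _)     (single _)     = refl
  path-unique (single _)     (cons _ x∉ q)  = ⊥-elim (x∉ (target∈ q))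
  path-unique (cons _ x∉ p)  (single _)     = ⊥-elim (x∉ (target∈ p))
  path-unique {x = x} (cons {v = w} e x∉xs p) (cons {v = w′} e′ x∉ys q) with em {w ≡ w′}
  ... | yes refl = cong (x ∷_) (path-unique p q)
  ... | no  w≢w′ = ⊥-elim (cycle (joined⇒path (proj₂ (Adj-V e)) (avoids x∉xs (source∈ p))
          (path⇒joined p (avoids x∉xs) ◅◅ joined-sym (path⇒joined q (avoids x∉ys)))))
    where
    avoids : ∀ {zs} → x ∉ˡ zs → ⟦ zs ⟧ ⊆ (_≢ x)
    avoids x∉zs z∈zs refl = x∉zs z∈zs

    cycle : ¬ (∃ λ zs → Path graph w w′ zs × ⟦ zs ⟧ ⊆ (_≢ x))
    cycle (_ , single _ , _) = w≢w′ refl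
    -- With `x` in front this path has exactly three vertices, the least number `acyclic` accepts.
    cycle (_ , r@(cons _ _ (single _)) , zs≢x) =
      acyclic (cons e (λ x∈ → zs≢x x∈ refl) r) ≤-refl (Adj-sym e′)
    cycle (_ , r@(cons _ _ (cons _ _ _)) , zs≢x) =
      acyclic (cons e (λ x∈ → zs≢x x∈ refl) r) (s≤s (s≤s (s≤s z≤n))) (Adj-sym e′)

  path-reverse : ∀ {x y xs} → Path graph x y xs → ∃ λ ys → Path graph y x ys × ⟦ ys ⟧ ⊆ ⟦ xs ⟧
  path-reverse p =
    joined⇒path (path⊆V p (target∈ p)) (target∈ p) (joined-sym (path⇒joined p id))

  -- `≤ᵀ` speaks of paths from the root, but recursion on a path consumes its start. Paths down to
  -- the root are therefore used throughout, with `≤⇒∈` and `∈⇒≤` as translation.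
  descent : ∀ {v} → v ∈ V → ∃ λ xs → Path graph v root xs
  descent v∈V = connected v∈V root∈V

  ≤⇒∈ : ∀ {u v xs} → u ≤ᵀ v → Path graph v root xs → u ∈ˡ xs
  ≤⇒∈ {u} (ys , q , u∈ys) p with zs , r , zs⊆xs ← path-reverse p =
    zs⊆xs (subst (u ∈ˡ_) (path-unique q r) u∈ys)

  ∈⇒≤ : ∀ {u v xs} → Path graph v root xs → u ∈ˡ xs → u ≤ᵀ v
  ∈⇒≤ {u} p u∈xs with ys , q , _ ← path-reverse p with zs , r , zs⊆ys ← path-reverse q =
    ys , q , zs⊆ys (subst (u ∈ˡ_) (path-unique p r) u∈xs)

  lower∈V : ∀ {u v} → u ≤ᵀ v → u ∈ V
  lower∈V (_ , p , u∈xs) = path⊆V p u∈xs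

  upper∈V : ∀ {u v} → u ≤ᵀ v → v ∈ V
  upper∈V (_ , p , _) = path⊆V p (target∈ p)

  ≤ᵀ-refl : ∀ {v} → v ∈ V → v ≤ᵀ v
  ≤ᵀ-refl v∈V = ∈⇒≤ (proj₂ (descent v∈V)) (source∈ (proj₂ (descent v∈V)))

  root-least : ∀ {v} → v ∈ V → root ≤ᵀ v
  root-least v∈V = ∈⇒≤ (proj₂ (descent v∈V)) (target∈ (proj₂ (descent v∈V)))

  ≤ᵀ-trans : ∀ {u v w} → u ≤ᵀ v → v ≤ᵀ w → u ≤ᵀ w
  ≤ᵀ-trans u≤v v≤w with xs , p ← descent (upper∈V v≤w)
    with ys , q , ys⊆xs , _ ← path-suffix p (≤⇒∈ v≤w p) = ∈⇒≤ p (ys⊆xs (≤⇒∈ u≤v q))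

  -- Both vertices lie on the unique descending path of `w`, and the one met first is the upper one.
  ≤ᵀ-linear : ∀ {u v w} → u ≤ᵀ w → v ≤ᵀ w → u ≤ᵀ v ⊎ v ≤ᵀ u
  ≤ᵀ-linear u≤w v≤w with xs , p ← descent (upper∈V u≤w) = go p (≤⇒∈ u≤w p) (≤⇒∈ v≤w p)
    where
    go : ∀ {u v w xs} → Path graph w root xs → u ∈ˡ xs → v ∈ˡ xs → u ≤ᵀ v ⊎ v ≤ᵀ u
    go p@(single _)   (here refl) v∈          = inj₂ (∈⇒≤ p v∈)
    go p@(cons _ _ _) (here refl) v∈          = inj₂ (∈⇒≤ p v∈)
    go p@(cons _ _ _) (there u∈)  (here refl) = inj₁ (∈⇒≤ p (there u∈))
    go (cons _ _ p)   (there u∈)  (there v∈)  = go p u∈ v∈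

  -- Junk value 0 outside V; the root has height 1.
  height : S → ℕ
  height v with em {∃ λ xs → Path graph v root xs}
  ... | yes (xs , _) = length xs
  ... | no  _        = 0

  height-path : ∀ {v xs} → Path graph v root xs → height v ≡ length xs
  height-path {v} p with em {∃ λ xs → Path graph v root xs}
  ... | yes (_ , q) = cong length (path-unique q p)
  ... | no  ∄p      = ⊥-elim (∄p (_ , p))

  <ᵀ⇒height< : ∀ {u v} → u <ᵀ v → height u < height v
  <ᵀ⇒height< (u≤v , u≢v) with xs , p ← descent (upper∈V u≤v)
    with ys , q , _ , _ , lt ← path-suffix p (≤⇒∈ u≤v p)
    rewrite height-path p | height-path q = lt u≢v

  ≤ᵀ⇒height≤ : ∀ {u v} → u ≤ᵀ v → height u ≤ height v
  ≤ᵀ⇒height≤ {u} {v} u≤v with em {u ≡ v}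
  ... | yes refl = ≤-refl
  ... | no  u≢v  = <⇒≤ (<ᵀ⇒height< (u≤v , u≢v))

  ≤ᵀ∧height≥⇒≡ : ∀ {u v} → u ≤ᵀ v → height v ≤ height u → u ≡ v
  ≤ᵀ∧height≥⇒≡ u≤v h = decidable-stable em λ u≢v → <⇒≱ (<ᵀ⇒height< (u≤v , u≢v)) h

  -- The list includes `v` itself.
  ancestors : ∀ {v} → v ∈ V → List S
  ancestors v∈V = proj₁ (descent v∈V)

  ancestors⊆V : ∀ {v} (v∈V : v ∈ V) → All V (ancestors v∈V)
  ancestors⊆V v∈V = All.tabulate (path⊆V (proj₂ (descent v∈V)))

  ∈ancestors⁺ : ∀ {u v} (v∈V : v ∈ V) → u ≤ᵀ v → u ∈ˡ ancestors v∈V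
  ∈ancestors⁺ v∈V u≤v = ≤⇒∈ u≤v (proj₂ (descent v∈V))

  child : ∀ {v t} → v <ᵀ t → ∃ λ c → Adj v c × v ≤ᵀ c × c ≤ᵀ t × height c ≡ 1+ height v
  child (v≤t , v≢t) with xs , p ← descent (upper∈V v≤t) = go p (≤⇒∈ v≤t p) v≢t
    where
    go : ∀ {v t xs} → Path graph t root xs → v ∈ˡ xs → v ≢ t →
      ∃ λ c → Adj v c × v ≤ᵀ c × c ≤ᵀ t × height c ≡ 1+ height v
    go (single _)   (here refl) v≢t = ⊥-elim (v≢t refl)
    go (cons _ _ _) (here refl) v≢t = ⊥-elim (v≢t refl)
    go {v} q@(cons {v = w} e _ p) (there v∈) v≢t with em {v ≡ w}
    ... | yes refl = _ , Adj-sym e , ∈⇒≤ q (there v∈) , ∈⇒≤ q (here refl) ,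
          trans (height-path q) (cong 1+_ (sym (height-path p)))
    ... | no  v≢w with c , vc , v≤c , c≤w , h ← go p v∈ v≢w =
          c , vc , v≤c , ≤ᵀ-trans c≤w (∈⇒≤ q (there (source∈ p))) , h

  -- Either `x` lies on the descending path of `y`, or prepending `x` to it gives the descending
  -- path of `x`, so that `y` is the parent of `x`.
  adjacent-cases : ∀ {x y} → Adj x y → x ≤ᵀ y ⊎ (y <ᵀ x × ∀ z → z ≤ᵀ x → z ≡ x ⊎ z ≤ᵀ y)
  adjacent-cases {x} {y} xy with xs , p ← descent (proj₂ (Adj-V xy)) with em {x ∈ˡ xs}
  ... | yes x∈xs = inj₁ (∈⇒≤ p x∈xs)
  ... | no  x∉xs = inj₂ ((∈⇒≤ q (there (source∈ p)) , λ { refl → irrefl refl xy }) , below)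
    where
    q = cons xy x∉xs p

    below : ∀ z → z ≤ᵀ x → z ≡ x ⊎ z ≤ᵀ y
    below z z≤x with ≤⇒∈ z≤x q
    ... | here z≡x = inj₁ z≡x
    ... | there z∈ = inj₂ (∈⇒≤ p z∈)

  -- A walk can leave the cone above `v` only by stepping down from `v`, which lies outside `W`.
  joined-above : ∀ {p} {W : Pred S p} {v x y} → v ∉ W →
    v ≤ᵀ x → Joined W x y → v ≤ᵀ y
  joined-above v∉W v≤x ε = v≤x
  joined-above {W = W} {v} {x} v∉W v≤x (_◅_ {j = z} (e , x∈W , _) s) =
    joined-above v∉W (step (adjacent-cases e)) s
    where
    step : x ≤ᵀ z ⊎ (z <ᵀ x × ∀ u → u ≤ᵀ x → u ≡ x ⊎ u ≤ᵀ z) → v ≤ᵀ z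
    step (inj₁ x≤z) = ≤ᵀ-trans v≤x x≤z
    step (inj₂ (_ , below)) with below v v≤x
    ... | inj₁ refl = ⊥-elim (v∉W x∈W)
    ... | inj₂ v≤z  = v≤z

  descend-joined : ∀ {v x} → v ≤ᵀ x → Joined (v ≤ᵀ_) x v
  descend-joined v≤x with xs , p ← descent (upper∈V v≤x) = go p (≤⇒∈ v≤x p)
    where
    go : ∀ {v x xs} → Path graph x root xs → v ∈ˡ xs → Joined (v ≤ᵀ_) x v
    go (single _)   (here refl) = ε
    go (cons _ _ _) (here refl) = ε
    go q@(cons e _ p) (there v∈) = (e , ∈⇒≤ q (there v∈) , ∈⇒≤ p v∈) ◅ go p v∈

  minimum : ∀ (P : Pred S a) {u} → u ∈ P →
    ∃ λ m → m ∈ P × ∀ w → w ∈ P → height m ≤ height w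
  minimum P {u} u∈P = go (height u) u∈P ≤-refl
    where
    go : ∀ n {u} → u ∈ P → height u ≤ n → ∃ λ m → m ∈ P × ∀ w → w ∈ P → height m ≤ height w
    go n {u} u∈P h≤n with em {∃ λ w → w ∈ P × height w < height u}
    ... | no ∄w = u , u∈P , λ w w∈P → ≮⇒≥ λ lt → ∄w (w , w∈P , lt)
    go zero   u∈P h≤0 | yes (w , w∈P , lt) = ⊥-elim (n≮0 (≤-trans lt h≤0))
    go (1+ n) u∈P h≤n | yes (w , w∈P , lt) = go n w∈P (s≤s⁻¹ (≤-trans lt h≤n))

  -- Rooted rays and chains in the tree.

  open Ray using (vertex; injective; adjacent)

  ray⊆V : ∀ (R : Ray graph) n → vertex R n ∈ V
  ray⊆V R n = proj₁ (Adj-V (adjacent R n))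

  vertices-infinite : ∀ (R : Ray graph) → ¬ Finite (vertices graph R)
  vertices-infinite R (X , sub , _)
    with k , avoid ← injective-avoids em (vertex R) (injective R) X =
    avoid k ≤-refl (sub (k , refl))

  almost-all-vertices : ∀ (R : Ray graph) {P} → vertices graph R ⊆* P →
    ∃ λ k → ∀ n → k ≤ n → vertex R n ∈ P
  almost-all-vertices R (X , sub , _)
    with k , avoid ← injective-avoids em (vertex R) (injective R) X =
    k , λ n k≤n → decidable-stable em λ ∉P → avoid n k≤n (sub ((n , refl) , ∉P))

  module _ (R : Ray graph) (rooted : Rooted R) where

    -- Listed from index `n` down to 0, to be the descending path of `vertex R n`.
    initial : ℕ → List S
    initial zero   = vertex R 0 ∷ []
    initial (1+ n) = vertex R (1+ n) ∷ initial n

    ∈initial⁺ : ∀ {m n} → m ≤ n → vertex R m ∈ˡ initial n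
    ∈initial⁺ {n = zero} z≤n = here refl
    ∈initial⁺ {n = 1+ n} m≤1+n with m≤n⇒m<n∨m≡n m≤1+n
    ... | inj₁ m<1+n = there (∈initial⁺ (s≤s⁻¹ m<1+n))
    ... | inj₂ refl  = here refl

    ∈initial⁻ : ∀ {x} n → x ∈ˡ initial n → ∃ λ m → m ≤ n × x ≡ vertex R m
    ∈initial⁻ zero   (here x≡) = zero , z≤n , x≡
    ∈initial⁻ (1+ n) (here x≡) = 1+ n , ≤-refl , x≡
    ∈initial⁻ (1+ n) (there x∈) with m , m≤n , x≡ ← ∈initial⁻ n x∈ = m , m≤n⇒m≤1+n m≤n , x≡

    initial-path : ∀ n → Path graph (vertex R n) root (initial n)
    initial-path zero   =
      subst (λ r → Path graph (vertex R 0) r (initial 0)) rooted (single (ray⊆V R 0))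
    initial-path (1+ n) = cons (Adj-sym (adjacent R n)) fresh (initial-path n)
      where
      fresh : vertex R (1+ n) ∉ˡ initial n
      fresh v∈ with m , m≤n , eq ← ∈initial⁻ n v∈ = <⇒≢ (s≤s m≤n) (sym (injective R eq))

    height-ray : ∀ n → height (vertex R n) ≡ 1+ n
    height-ray n = trans (height-path (initial-path n)) (length-initial n)
      where
      length-initial : ∀ n → length (initial n) ≡ 1+ n
      length-initial zero   = refl
      length-initial (1+ n) = cong 1+_ (length-initial n)

    ray-mono : ∀ {m n} → m ≤ n → vertex R m ≤ᵀ vertex R n
    ray-mono m≤n = ∈⇒≤ (initial-path _) (∈initial⁺ m≤n)

    below-ray : ∀ {x} n → x ≤ᵀ vertex R n → ∃ λ m → x ≡ vertex R m
    below-ray n x≤ with m , _ , x≡ ← ∈initial⁻ n (≤⇒∈ x≤ (initial-path n)) = m , x≡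

    -- The vertex at index `n` has height `1+ n`, so beyond index `height x` it is too high to lie
    -- below `x`.
    ray-leaves : ∀ X → ∃ λ k → ∀ n → k ≤ n → ∀ x → x ∈ˡ X → ¬ vertex R n ≤ᵀ x
    ray-leaves = eventually (λ n x → ¬ vertex R n ≤ᵀ x) λ x → height x , λ n h≤n n≤x →
      1+n≰n (≤-trans (≤-reflexive (sym (height-ray n))) (≤-trans (≤ᵀ⇒height≤ n≤x) h≤n))

  -- Everything below a vertex of `R′` lies on `R′`, so `vertex R n` is some `vertex R′ m`;
  -- comparing heights gives `m ≡ n`.
  cofinal⇒≗ : ∀ (R R′ : Ray graph) → Rooted R → Rooted R′ →
    (∀ n → ∃ λ k → vertex R n ≤ᵀ vertex R′ k) → _≗ᴿ_ graph R R′
  cofinal⇒≗ R R′ rooted rooted′ cofinal n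
    with k , n≤k ← cofinal n with m , Rn≡R′m ← below-ray R′ rooted′ k n≤k =
    trans Rn≡R′m (cong (vertex R′) (suc-injective
      (trans (sym (height-ray R′ rooted′ m))
        (trans (cong height (sym Rn≡R′m)) (height-ray R rooted n)))))

  module _ {p} (P : Pred S p) (root∈P : root ∈ P)
    (downward : ∀ {u v} → u ≤ᵀ v → v ∈ P → u ∈ P)
    (directed : ∀ {u v} → u ∈ P → v ∈ P → ∃ λ w → u ≤ᵀ w × v ≤ᵀ w)
    (unbounded : ∀ {v} → v ∈ P → ∃ λ t → t ∈ P × v <ᵀ t) where

    private
      next : ∃ P → ∃ P
      -- The vertex `t` may be far above `v`; the child of `v` towards `t` is adjacent to `v` and
      -- stays in `P` by downward closure.
      next (v , v∈P) with t , t∈P , v<t ← unbounded v∈P with c , _ , _ , c≤t , _ ← child v<t =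
        c , downward c≤t t∈P

      next-adj : ∀ s → Adj (proj₁ s) (proj₁ (next s))
      next-adj (v , v∈P) = proj₁ (proj₂ (child (proj₂ (proj₂ (unbounded v∈P)))))

      next-height : ∀ s → height (proj₁ (next s)) ≡ 1+ height (proj₁ s)
      next-height (v , v∈P) =
        proj₂ (proj₂ (proj₂ (proj₂ (child (proj₂ (proj₂ (unbounded v∈P)))))))

      climb : ℕ → ∃ P
      climb zero   = root , root∈P
      climb (1+ n) = next (climb n)

      climb-height : ∀ n → height (proj₁ (climb n)) ≡ 1+ n
      climb-height zero   = height-path (single root∈V)
      climb-height (1+ n) = trans (next-height (climb n)) (cong 1+_ (climb-height n))

      ray : Ray graph
      ray = record
        { vertex    = proj₁ ∘ climb
        ; injective = λ {m} {n} eq → suc-injective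
            (trans (sym (climb-height m)) (trans (cong height eq) (climb-height n)))
        ; adjacent  = next-adj ∘ climb
        }

      exhausts : ∀ v → v ∈ P → ∃ λ n → vertex ray n ≡ v
      exhausts v v∈P = at (proj₂ (descent v∈V))
        where
        v∈V = lower∈V (proj₁ (proj₂ (proj₂ (unbounded v∈P))))

        same-height : ∀ n → height v ≡ 1+ n → vertex ray n ≡ v
        same-height n h with w , v≤w , n≤w ← directed v∈P (proj₂ (climb n)) with ≤ᵀ-linear v≤w n≤w
        ... | inj₁ v≤n = sym (≤ᵀ∧height≥⇒≡ v≤n (≤-reflexive (trans (climb-height n) (sym h))))
        ... | inj₂ n≤v = ≤ᵀ∧height≥⇒≡ n≤v (≤-reflexive (trans h (sym (climb-height n))))

        at : ∀ {xs} → Path graph v root xs → ∃ λ n → vertex ray n ≡ v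
        at p@(single _)            = 0 , same-height 0 (height-path p)
        -- The root has height 1 but index 0, so the index is the length of the path without its
        -- first vertex.
        at p@(cons {xs = xs} _ _ _) = length xs , same-height (length xs) (height-path p)

    -- By `directed` and `≤ᵀ-linear`, `P` is a chain and has at most one vertex of each height. The
    -- ray climbs one height at a time, so it meets every vertex of `P`. Both `EventuallyBelow` and
    -- `Below` become rays this way.
    chain⇒ray : ∃ λ R → Rooted R × (∀ n → vertex R n ∈ P) ×
      (∀ v → v ∈ P → ∃ λ n → vertex R n ≡ v)
    chain⇒ray = ray , refl , proj₂ ∘ climb , exhausts

  -- Equivalence of rays and the rooted ray of a tree end.

  joinedAvoiding⇒joined : ∀ {X x y} → JoinedAvoiding graph X x y → Joined (∁ ⟦ X ⟧) x y
  joinedAvoiding⇒joined (_ , p , avoid) = path⇒joined p (All.lookup avoid)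

  joined⇒joinedAvoiding : ∀ {X x y} → x ∈ V → x ∉ˡ X → Joined (∁ ⟦ X ⟧) x y →
    JoinedAvoiding graph X x y
  joined⇒joinedAvoiding x∈V x∉X s with xs , p , avoid ← joined⇒path x∈V x∉X s =
    xs , p , All.tabulate avoid

  rayEquivalent-sym : ∀ {R Q} → RayEquivalent graph R Q → RayEquivalent graph Q R
  rayEquivalent-sym R~Q X X⊆V with m , n , join ← R~Q X X⊆V = n , m , λ i j n≤i m≤j →
    let xs , p , avoid = join j i m≤j n≤i in
    joined⇒joinedAvoiding (path⊆V p (target∈ p)) (All.lookup avoid (target∈ p))
      (joined-sym (joinedAvoiding⇒joined (xs , p , avoid)))

  rayEquivalent-trans : ∀ {R Q P} →
    RayEquivalent graph R Q → RayEquivalent graph Q P → RayEquivalent graph R P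
  rayEquivalent-trans R~Q Q~P X X⊆V
    with m , n , join ← R~Q X X⊆V | n′ , k , join′ ← Q~P X X⊆V =
    m , k , λ i j m≤i k≤j →
    let xs , p , avoid = join i (n ⊔ n′) m≤i (m≤m⊔n n n′) in
    joined⇒joinedAvoiding (path⊆V p (source∈ p)) (All.lookup avoid (source∈ p))
      (joinedAvoiding⇒joined (xs , p , avoid) ◅◅
       joinedAvoiding⇒joined (join′ (n ⊔ n′) j (m≤n⊔m n n′) k≤j))

  rayEquivalent-resp-≗ : ∀ {R R′ Q} → _≗ᴿ_ graph R R′ →
    RayEquivalent graph R Q → RayEquivalent graph R′ Q
  rayEquivalent-resp-≗ R≗R′ R~Q X X⊆V with m , n , join ← R~Q X X⊆V =
    m , n , λ i j m≤i n≤j →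
    subst (λ x → JoinedAvoiding graph X x _) (R≗R′ i) (join i j m≤i n≤j)

  -- For `m` large no element of `X` lies above `vertex R m`; tails of both rays lie in the cone
  -- above that vertex and are joined by descending to it.
  equivalent-above : ∀ R Q → Rooted R → (∀ m → ∃ λ n → ∀ j → n ≤ j → vertex R m ≤ᵀ vertex Q j) →
    RayEquivalent graph R Q
  equivalent-above R Q rooted above X _
    with m , leaves ← ray-leaves R rooted X with n , Rm≤ ← above m =
    m , n , λ i j m≤i n≤j →
    joined⇒joinedAvoiding (ray⊆V R i)
      (λ Ri∈X → leaves m ≤-refl _ Ri∈X (ray-mono R rooted m≤i))
      (joined-mono (λ Rm≤x x∈X → leaves m ≤-refl _ x∈X Rm≤x)
        (descend-joined (ray-mono R rooted m≤i) ◅◅ joined-sym (descend-joined (Rm≤ j n≤j))))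

  rayEquivalent-refl : ∀ R → Rooted R → RayEquivalent graph R R
  rayEquivalent-refl R rooted = equivalent-above R R rooted λ m →
    m , λ j m≤j → ray-mono R rooted m≤j

  -- After deletion of the ancestors of `vertex R n`, a tail of `R` lies in the cone above that
  -- vertex, and walks from there to `R′` cannot leave the cone.
  rayEquivalent⇒≗ : ∀ R R′ → Rooted R → Rooted R′ → RayEquivalent graph R R′ → _≗ᴿ_ graph R R′
  rayEquivalent⇒≗ R R′ rooted rooted′ R~R′ = cofinal⇒≗ R R′ rooted rooted′ λ n →
    let v∈V = ray⊆V R n
        m , k , join = R~R′ (ancestors v∈V) (ancestors⊆V v∈V) in
    k , joined-above (λ v∉X → v∉X (∈ancestors⁺ v∈V (≤ᵀ-refl v∈V)))
          (ray-mono R rooted (m≤n⊔m m n))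
          (joinedAvoiding⇒joined (join (m ⊔ n) k (m≤m⊔n m n) ≤-refl))

  -- The vertices that are eventually below Q form the rooted ray of Q's end.
  module _ (Q : Ray graph) where
    EventuallyBelow : Pred S a
    EventuallyBelow v = ∃ λ n → ∀ i → n ≤ i → v ≤ᵀ vertex Q i

    private
      directed : ∀ {u v} → u ∈ EventuallyBelow → v ∈ EventuallyBelow → ∃ λ w → u ≤ᵀ w × v ≤ᵀ w
      directed (m , u≤) (n , v≤) =
        vertex Q (m ⊔ n) , u≤ (m ⊔ n) (m≤m⊔n m n) , v≤ (m ⊔ n) (m≤n⊔m m n)

      strictly : ∀ {v} → v ∈ EventuallyBelow → ∃ λ n → ∀ i → n ≤ i → v <ᵀ vertex Q i
      strictly {v} (n , v≤) with k , avoid ← injective-avoids em (vertex Q) (injective Q) (v ∷ []) =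
        n ⊔ k , λ i n⊔k≤i → v≤ i (≤-trans (m≤m⊔n n k) n⊔k≤i) ,
          λ v≡Qi → avoid i (≤-trans (m≤n⊔m n k) n⊔k≤i) (here (sym v≡Qi))

      unbounded : ∀ {v} → v ∈ EventuallyBelow → ∃ λ t → t ∈ EventuallyBelow × v <ᵀ t
      unbounded {v} v∈ with n , v< ← strictly v∈
        with c , _ , v≤c , c≤Qn , h ← child (v< n ≤-refl) =
        c , (n , λ i n≤i → subst (λ j → c ≤ᵀ vertex Q j) (m∸n+n≡m n≤i) (above (i ∸ n))) ,
        v≤c , λ { refl → 1+n≢n (sym h) }
        where
        above : ∀ i → c ≤ᵀ vertex Q (i + n)
        above zero   = c≤Qn
        above (1+ i) with adjacent-cases (adjacent Q (i + n))
        ... | inj₁ up = ≤ᵀ-trans (above i) up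
        ... | inj₂ (down , below) with below c (above i)
        ...   | inj₂ c≤ = c≤
        -- Leaving the cone above `c` means stepping down from `c` to height at most that of `v`,
        -- although `v` is strictly below all these vertices.
        ...   | inj₁ c≡ = ⊥-elim (<⇒≱ (<ᵀ⇒height< (v< (1+ i + n) (m≤n+m n (1+ i))))
                (s≤s⁻¹ (≤-trans (<ᵀ⇒height< down)
                  (≤-reflexive (trans (cong height (sym c≡)) h)))))

    rootedRay : ∃ λ R → RayEquivalent graph Q R × Rooted R
    rootedRay =
      let R , rooted , R⊆P , _ = chain⇒ray EventuallyBelow
            (0 , λ i _ → root-least (ray⊆V Q i))
            (λ u≤v (n , v≤) → n , λ i n≤i → ≤ᵀ-trans u≤v (v≤ i n≤i))
            directed unbounded
      in R , rayEquivalent-sym {R} {Q} (equivalent-above R Q rooted R⊆P) , rooted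

  rootedRayOf : (ω : GraphEnd graph) → ∃ (IsRootedRayOf ω)
  rootedRayOf ω =
    let Q , _ , Q~⊆ω = isClass ω
        R , Q~R , rooted = rootedRay Q
    in R , Q~⊆ω {R} Q~R , rooted

  rootedRayOf-unique : ∀ ω {R R′} → IsRootedRayOf ω R → IsRootedRayOf ω R′ → _≗ᴿ_ graph R R′
  rootedRayOf-unique ω {R} {R′} (R∈ω , rooted) (R′∈ω , rooted′) =
    let Q , ω⊆Q~ , _ = isClass ω in
    rayEquivalent⇒≗ R R′ rooted rooted′
      (rayEquivalent-trans {R} {Q} {R′} (rayEquivalent-sym {Q} {R} (ω⊆Q~ {R} R∈ω)) (ω⊆Q~ {R′} R′∈ω))

-- The bijection between the ends of T and the ends in the closure of V(T)

module NormalTree {a} (em : ExcludedMiddle a) (𝒮 : Connectoid a)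
  (T : RootedTree (Connectoid.S 𝒮)) (normal : IsNormalTree 𝒮 T) where
  open Connectoid 𝒮
  open RootedTree T using (graph; V; root; _≤ᵀ_; _<ᵀ_; Rooted; IsRootedRayOf)
  open Limits em 𝒮
  open TreeOrder em T
  open IsNormalTree normal
  open IsWeakNormalTree isWeakNormalTree
  open Ray using (vertex)

  -- A vertex of minimal height works: for a vertex incomparable to `m`, condition (1) gives a
  -- common lower bound in `C`, which minimality identifies with `m`.
  least : ∀ {C} → Connected 𝒮 C → C ≬ V → ∃ λ m → m ∈ C × m ∈ V × ∀ u → u ∈ C → u ∈ V → m ≤ᵀ u
  least {C} C-conn (u , u∈C , u∈V)
    with m , (m∈C , m∈V) , minimal ← minimum (λ x → x ∈ C × x ∈ V) (u∈C , u∈V) =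
    m , m∈C , m∈V , below
    where
    below : ∀ u → u ∈ C → u ∈ V → m ≤ᵀ u
    below u u∈C u∈V with em {m ≤ᵀ u} | em {u ≤ᵀ m}
    ... | yes m≤u | _       = m≤u
    ... | no  _   | yes u≤m =
      subst (m ≤ᵀ_) (sym (≤ᵀ∧height≥⇒≡ u≤m (minimal u (u∈C , u∈V)))) (≤ᵀ-refl m∈V)
    ... | no  m≰u | no  u≰m
      with w , w∈C , w≤m , w≤u ← incomparable C C-conn m u m∈C m∈V u∈C u∈V m≰u u≰m =
      subst (_≤ᵀ u) (≤ᵀ∧height≥⇒≡ w≤m (minimal w (w∈C , lower∈V w≤m))) w≤u

  -- The least vertex `m` of `C` and the vertex `v` are both below `u`, hence comparable; `m ≤ᵀ v`
  -- would put an ancestor of `v` into `C`.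
  cone : ∀ {C v} (v∈V : v ∈ V) → Connected 𝒮 C → C ⊆ ∁ ⟦ ancestors v∈V ⟧ →
    ∀ {u w} → u ∈ C → v ≤ᵀ u → w ∈ C → w ∈ V → v ≤ᵀ w
  cone v∈V C-conn avoid u∈C v≤u w∈C w∈V
    with m , m∈C , _ , m≤ ← least C-conn (_ , u∈C , upper∈V v≤u)
    with ≤ᵀ-linear v≤u (m≤ _ u∈C (upper∈V v≤u))
  ... | inj₁ v≤m = ≤ᵀ-trans v≤m (m≤ _ w∈C w∈V)
  ... | inj₂ m≤v = ⊥-elim (avoid m∈C (∈ancestors⁺ v∈V m≤v))

  necklaceOf : ∀ R → Rooted R → Necklace 𝒮
  necklaceOf R rooted = proj₁ (rayNecklace R rooted)

  converges : ∀ R (rooted : Rooted R) →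
    ConvergesTo 𝒮 (vertices graph R) (endOf (necklaceOf R rooted))
  converges R rooted = ⊆*⇒ConvergesTo (necklaceOf R rooted)
    (vertices-infinite R) (proj₂ (rayNecklace R rooted))

  converges-resp-≗ : ∀ {R R′} ν → _≗ᴿ_ graph R R′ →
    ConvergesTo 𝒮 (vertices graph R) ν → ConvergesTo 𝒮 (vertices graph R′) ν
  converges-resp-≗ {R} {R′} ν R≗R′ (_ , R→ν) = vertices-infinite R′ , λ X →
    let K , K-ν , Z , R∖K⊆Z , _ = R→ν X in
    K , K-ν , ⊆-list⇒Finite em Z λ ((n , R′n≡x) , x∉K) → R∖K⊆Z ((n , trans (R≗R′ n) R′n≡x) , x∉K)

  limit-in-closure : ∀ R (rooted : Rooted R) → InClosure 𝒮 V (endOf (necklaceOf R rooted))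
  limit-in-closure R rooted X =
    let K , K-ν , R⊆*K = proj₂ (converges R rooted) X
        k , Rn∈K = almost-all-vertices R R⊆*K
    in K , K-ν , vertex R k , Rn∈K k ≤-refl , ray⊆V R k

  -- With the ancestors of `vertex R n` deleted, both rays have tails in the same component, so
  -- `cone` places a vertex of `R′` above `vertex R n`.
  common-limit⇒≗ : ∀ R R′ → Rooted R → Rooted R′ → ∀ ν →
    ConvergesTo 𝒮 (vertices graph R) ν → ConvergesTo 𝒮 (vertices graph R′) ν → _≗ᴿ_ graph R R′
  common-limit⇒≗ R R′ rooted rooted′ ν (_ , R→ν) (_ , R′→ν) = cofinal⇒≗ R R′ rooted rooted′ λ n →
    let v∈V = ray⊆V R n
        K  , (𝒦K  , K-tails)  , R⊆*K   = R→ν (ancestors v∈V)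
        K′ , (𝒦K′ , K′-tails) , R′⊆*K′ = R′→ν (ancestors v∈V)
        K′⊆K = component-mono 𝒦K 𝒦K′ id (⊆*-meet em (necklace-infinite (representative ν))
                 (IsK⇒⊆* ν (𝒦K , K-tails)) (IsK⇒⊆* ν (𝒦K′ , K′-tails)))
        m , R∈K   = almost-all-vertices R R⊆*K
        k , R′∈K′ = almost-all-vertices R′ R′⊆*K′
    in k , cone v∈V (𝒦.connected 𝒦K) (𝒦.subset 𝒦K) (R∈K (m ⊔ n) (m≤m⊔n m n))
             (ray-mono R rooted (m≤n⊔m m n)) (K′⊆K (R′∈K′ k ≤-refl)) (ray⊆V R′ k)

  -- From an end in the closure of the tree to a rooted ray.

  module _ (ν : End 𝒮) (ν∈closure : InClosure 𝒮 V ν) where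

    private
      K⟨_⟩ : List S → Pred S a
      K⟨ X ⟩ = proj₁ (ν∈closure X)

      K-component : ∀ X → 𝒦 𝒮 (∁ ⟦ X ⟧) K⟨ X ⟩
      K-component X = proj₁ (proj₁ (proj₂ (ν∈closure X)))

      K-tail : ∀ X → proj₁ (representative ν) ⊆* K⟨ X ⟩
      K-tail X = IsK⇒⊆* ν (proj₁ (proj₂ (ν∈closure X)))

      K-V : ∀ X → K⟨ X ⟩ ≬ V
      K-V X = proj₂ (proj₂ (ν∈closure X))

      K-antitone : ∀ {X Y} → ⟦ X ⟧ ⊆ ⟦ Y ⟧ → K⟨ Y ⟩ ⊆ K⟨ X ⟩
      K-antitone {X} {Y} X⊆Y = component-mono (K-component X) (K-component Y) (_∘ X⊆Y)
        (⊆*-meet em (necklace-infinite (representative ν)) (K-tail X) (K-tail Y))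

      Below : Pred S a
      Below v = ∃ λ X → ∀ u → u ∈ K⟨ X ⟩ → u ∈ V → v ≤ᵀ u

      least-Below : ∀ X → ∃ λ m → m ∈ Below × m ∈ K⟨ X ⟩ × m ∈ V
      least-Below X with m , m∈K , m∈V , m≤ ← least (𝒦.connected (K-component X)) (K-V X) =
        m , (X , m≤) , m∈K , m∈V

      directed : ∀ {u v} → u ∈ Below → v ∈ Below → ∃ λ w → u ≤ᵀ w × v ≤ᵀ w
      directed (X , u≤) (Y , v≤) with w , w∈K , w∈V ← K-V (X ++ Y) =
        w , u≤ w (K-antitone ∈-++⁺ˡ w∈K) w∈V , v≤ w (K-antitone (∈-++⁺ʳ X) w∈K) w∈V

      unbounded : ∀ {v} → v ∈ Below → ∃ λ t → t ∈ Below × v <ᵀ t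
      unbounded {v} (X , v≤) with m , m∈Below , m∈K , m∈V ← least-Below (v ∷ X) =
        m , m∈Below , v≤ m (K-antitone there m∈K) m∈V ,
        λ { refl → 𝒦.subset (K-component (v ∷ X)) m∈K (here refl) }

      limit : ∀ R (rooted : Rooted R) → (∀ v → v ∈ Below → ∃ λ n → vertex R n ≡ v) →
        Setoid._≈_ (Ends 𝒮) (endOf (necklaceOf R rooted)) ν
      limit R rooted Below⊆R = equivalent⇒≈ (endOf N) ν (equivalent N (representative ν) λ X →
        let K , K-η , R⊆*K = proj₂ (converges R rooted) X
        in K , proj₁ K-η , IsK⇒⊆* (endOf N) K-η ,
           ⊆*-mono em (K-tail X) (component-mono (proj₁ K-η) (K-component X) id (meet X R⊆*K)))
        where
        N = necklaceOf R rooted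

        meet : ∀ X {K} → vertices graph R ⊆* K → K ≬ K⟨ X ⟩
        -- `Z` lists the ray vertices outside `K`. With `Z` deleted too, the least vertex of the
        -- component still lies on the ray, but outside `Z`, and hence in `K`.
        meet X {K} (Z , R∖K⊆Z , _) with m , m∈Below , m∈K⟨⟩ , _ ← least-Below (X ++ Z) =
          m , decidable-stable em (λ m∉K →
            𝒦.subset (K-component (X ++ Z)) m∈K⟨⟩ (∈-++⁺ʳ X (R∖K⊆Z (Below⊆R m m∈Below , m∉K)))) ,
          K-antitone ∈-++⁺ˡ m∈K⟨⟩

    rayConvergingTo : ∃ λ R → Σ (Rooted R) λ rooted →
      Setoid._≈_ (Ends 𝒮) (endOf (necklaceOf R rooted)) ν
    rayConvergingTo =
        let R , rooted , _ , Below⊆R = chain⇒ray Below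
              ([] , λ _ _ → root-least)
              (λ u≤v (X , v≤) → X , λ w w∈K w∈V → ≤ᵀ-trans u≤v (v≤ w w∈K w∈V))
              directed unbounded
        in R , rooted , limit R rooted Below⊆R

  -- The limit map and its bijectivity.

  classOf : Ray graph → GraphEnd graph
  classOf R = record { members = RayEquivalent graph R ; isClass = R , id , id }

  rayOf : GraphEnd graph → Ray graph
  rayOf ω = proj₁ (rootedRayOf ω)

  rayOf-rooted : ∀ ω → Rooted (rayOf ω)
  rayOf-rooted ω = proj₂ (proj₂ (rootedRayOf ω))

  limitOf : GraphEnd graph → Σ (End 𝒮) (InClosure 𝒮 V)
  limitOf ω = endOf (necklaceOf R rooted) , limit-in-closure R rooted
    where
    R      = rayOf ω
    rooted = rayOf-rooted ω

  rayOf-converges : ∀ ω → ConvergesTo 𝒮 (vertices graph (rayOf ω)) (proj₁ (limitOf ω))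
  rayOf-converges ω = converges (rayOf ω) (rayOf-rooted ω)

  limit-converges : ∀ ω R → IsRootedRayOf ω R → ConvergesTo 𝒮 (vertices graph R) (proj₁ (limitOf ω))
  limit-converges ω R R-ω = converges-resp-≗ {rayOf ω} {R} (proj₁ (limitOf ω))
    (rootedRayOf-unique ω {rayOf ω} {R} (proj₂ (rootedRayOf ω)) R-ω) (rayOf-converges ω)

  -- The representative of `ω′` is linked to `M` through the shared rooted ray and the
  -- representative of `ω`. The two rooted rays agree only pointwise, hence `rayEquivalent-resp-≗`.
  same-rootedRay⇒⊆ : ∀ ω ω′ → _≗ᴿ_ graph (rayOf ω) (rayOf ω′) → members ω ⊆ members ω′
  same-rootedRay⇒⊆ ω ω′ R≗R′ {M} M∈ω =
    let R  = rayOf ω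
        R′ = rayOf ω′
        Q  , ω⊆Q~   , _      = isClass ω
        Q′ , ω′⊆Q′~ , Q′~⊆ω′ = isClass ω′
        R~Q   = rayEquivalent-sym {Q} {R} (ω⊆Q~ {R} (proj₁ (proj₂ (rootedRayOf ω))))
        Q′~R′ = ω′⊆Q′~ {R′} (proj₁ (proj₂ (rootedRayOf ω′)))
        R′~M  = rayEquivalent-trans {R′} {Q} {M}
                  (rayEquivalent-resp-≗ {R} {R′} {Q} R≗R′ R~Q) (ω⊆Q~ {M} M∈ω)
    in Q′~⊆ω′ {M} (rayEquivalent-trans {Q′} {R′} {M} Q′~R′ R′~M)

  -- The ray chosen for `ω` is also a rooted ray of `ω′`, so its vertex set converges to both
  -- limits.
  limitOf-cong : ∀ ω ω′ → Setoid._≈_ (GraphEnds graph) ω ω′ →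
    Setoid._≈_ (EndsInClosure 𝒮 V) (limitOf ω) (limitOf ω′)
  limitOf-cong ω ω′ (ω⊆ω′ , _) = limit-unique (proj₁ (limitOf ω)) (proj₁ (limitOf ω′))
    (rayOf-converges ω)
    (limit-converges ω′ R (ω⊆ω′ {R} (proj₁ (proj₂ (rootedRayOf ω))) , rayOf-rooted ω))
    where R = rayOf ω

  limitOf-injective : ∀ ω ω′ → Setoid._≈_ (EndsInClosure 𝒮 V) (limitOf ω) (limitOf ω′) →
    Setoid._≈_ (GraphEnds graph) ω ω′
  limitOf-injective ω ω′ η≈η′ =
    same-rootedRay⇒⊆ ω ω′ R≗R′ , same-rootedRay⇒⊆ ω′ ω λ n → sym (R≗R′ n)
    where
    R≗R′ : _≗ᴿ_ graph (rayOf ω) (rayOf ω′)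
    R≗R′ = common-limit⇒≗ (rayOf ω) (rayOf ω′) (rayOf-rooted ω) (rayOf-rooted ω′)
      (proj₁ (limitOf ω′))
      (converges-resp-≈ (proj₁ (limitOf ω)) (proj₁ (limitOf ω′)) η≈η′ (rayOf-converges ω))
      (rayOf-converges ω′)

  limitOf-surjective : ∀ (ν : Σ (End 𝒮) (InClosure 𝒮 V)) →
    ∃ λ ω → Setoid._≈_ (EndsInClosure 𝒮 V) (limitOf ω) ν
  limitOf-surjective (ν , ν∈closure) =
    let R , rooted , η≈ν = rayConvergingTo ν ν∈closure
        ω = classOf R
    in ω , limit-unique (proj₁ (limitOf ω)) ν
         -- The ray chosen for the class of `R` may be another term than `R`, so convergence is
         -- transferred to `R` first.
         (limit-converges ω R (rayEquivalent-refl R rooted , rooted))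
         (converges-resp-≈ (endOf (necklaceOf R rooted)) ν η≈ν (converges R rooted))

theorem5p2 : {a : Level} → ExcludedMiddle (suc a) →
    (𝒮 : Connectoid a) (T : RootedTree (Connectoid.S 𝒮)) → IsNormalTree 𝒮 T →
    let open RootedTree T in
    ((ω : GraphEnd graph) → ∃! (_≗ᴿ_ graph) (IsRootedRayOf ω)) ×
    Σ (Bijection (GraphEnds graph) (EndsInClosure 𝒮 V)) λ η →
    (ω : GraphEnd graph) (R : Ray graph) → IsRootedRayOf ω R →
    ConvergesTo 𝒮 (vertices graph R) (proj₁ (Bijection.to η ω)) ×
    ((ν : End 𝒮) → ConvergesTo 𝒮 (vertices graph R) ν →
    Setoid._≈_ (Ends 𝒮) ν (proj₁ (Bijection.to η ω)))
theorem5p2 {a} em₊ 𝒮 T normal =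
  (λ ω → rayOf ω , proj₂ (rootedRayOf ω) ,
    λ {R} R-ω → rootedRayOf-unique ω {rayOf ω} {R} (proj₂ (rootedRayOf ω)) R-ω) ,
  record
    { to        = limitOf
    ; cong      = λ {ω} {ω′} → limitOf-cong ω ω′
    ; bijective = (λ {ω} {ω′} → limitOf-injective ω ω′) , λ ν →
        let ω , η≈ν = limitOf-surjective ν in
        ω , λ {ω′} ω′≈ω → Setoid.trans (EndsInClosure 𝒮 (RootedTree.V T))
          {limitOf ω′} {limitOf ω} {ν} (limitOf-cong ω′ ω ω′≈ω) η≈ν
    } ,
  λ ω R R-ω → limit-converges ω R R-ω , λ ν R→ν →
    limit-unique ν (proj₁ (limitOf ω)) R→ν (limit-converges ω R R-ω)
  where
  em : ExcludedMiddle a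
  em = lowerExcludedMiddle em₊

  open Limits em 𝒮
  open TreeOrder em T
  open NormalTree em 𝒮 T normal
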